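{- For any integers $r\geq 2$ and $t\geq 1$ there exists a constant $C=C(r,t)$ such that, for all sufficiently large $n$, $\mathrm{ex}_r(K_n,\mathcal{F}_t^r)\le C n^{2-1/t'}$, where $t'=t r^{r-1}$.
   Context: Let $k,t,r$ be positive integers. An $r$-edge-colored complete graph $H=K_{kt}$ belongs to the family $\mathcal{F}_t^r$ if there is a partition $V(H)=V_1\sqcup\dots\sqcup V_k$ with $|V_i|=t$ for all $i$ such that: (1) for all $i,j\in[k]$, the edges inside $V_i$ all have the same color, and the edges between $V_i$ and $V_j$ all have the same color; (2) all $r$ colors appear in $H$; (3) for no $i\in[k]$ do all $r$ colors appear in $H\setminus V_i$. ($\mathcal{F}_t^r$ is the union over all $k$ of such graphs.) For a family $\mathcal{F}$ of $r$-edge-colored graphs, $\mathrm{ex}_r(K_n,\mathcal{F})$ denotes the minimum integer $m$ (if it exists) such that every $r$-edge-coloring of $K_n$ with more than $m$ edges in each of the $r$ colors contains a color-preserving copy of a member of $\mathcal{F}$; if no such $m$ exists it is $\infty$. -}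

module Defs where

open import Data.Nat using (ℕ; _<_; _≤_; _*_; _^_; _∸_)
open import Data.Fin using (Fin) renaming (_<?_ to _<ᶠ?_; _≟_ to _≟ᶠ_; _<_ to _<ᶠ_)
open import Data.List using (List; length; filter; allFin; cartesianProduct)
open import Data.Product using (Σ; ∃; _×_; _,_; proj₁; proj₂)
open import Relation.Nullary using (¬_)
open import Relation.Nullary.Decidable using (_×-dec_)
open import Relation.Binary.PropositionalEquality using (_≡_; _≢_)
open import Function.Definitions using (Injective)

-- An r-edge-coloring of the complete graph K_n on vertex set Fin n:
-- the colour of edge {u,v} (u ≢ v) is c u v; symmetry is required separately.
EdgeColoring : ℕ → ℕ → Set
EdgeColoring n r = Fin n → Fin n → Fin r

Symmetric : ∀ {n r} → EdgeColoring n r → Set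
Symmetric c = ∀ u v → c u v ≡ c v u

edgesOfColor : ∀ {n r} → EdgeColoring n r → Fin r → ℕ
edgesOfColor {n} c a =
  length (filter (λ p → (proj₁ p <ᶠ? proj₂ p) ×-dec (c (proj₁ p) (proj₂ p) ≟ᶠ a))
                 (cartesianProduct (allFin n) (allFin n)))

partSize : ∀ {m k} → (Fin m → Fin k) → Fin k → ℕ
partSize {m} p i = length (filter (λ u → p u ≟ᶠ i) (allFin m))

InFamily : (t r m : ℕ) → EdgeColoring m r → Set
InFamily t r m H =
  Symmetric H ×
  Σ ℕ λ k → (m ≡ k * t) ×
  Σ (Fin m → Fin k) λ p →
    (∀ i → partSize p i ≡ t) ×
    (∀ u v u' v' → u ≢ v → u' ≢ v' → p u ≡ p u' → p v ≡ p v' → H u v ≡ H u' v') ×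
    (∀ (a : Fin r) → ∃ λ u → ∃ λ v → u ≢ v × H u v ≡ a) ×
    (∀ (i : Fin k) → ¬ (∀ (a : Fin r) → ∃ λ u → ∃ λ v →
        u ≢ v × p u ≢ i × p v ≢ i × H u v ≡ a))

ContainsCopy : ∀ {n m r} → EdgeColoring n r → EdgeColoring m r → Set
ContainsCopy {n} {m} c H =
  Σ (Fin m → Fin n) λ φ → Injective _≡_ _≡_ φ × (∀ u v → u ≢ v → c (φ u) (φ v) ≡ H u v)

-- m is admissible in the definition of ex_r(K_n, F_t^r): every r-colouring of K_n
-- with more than m edges of each colour contains a copy of a member of F_t^r.
-- ex_r(K_n, F_t^r) is the least such m (∞ if none).
ExAdmissible : (r t n m : ℕ) → Set
ExAdmissible r t n m =
  ∀ (c : EdgeColoring n r) → Symmetric c → (∀ a → m < edgesOfColor c a) →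
  ∃ λ h → Σ (EdgeColoring h r) λ H → InFamily t r h H × ContainsCopy c H

-- ex_r(K_n, F_t^r) ≤ X  (X ∈ ℝ≥0)  iff  some admissible m is ≤ X (admissibility is upward closed).
-- With X = C n^(2 - 1/t') and C, m ≥ 0: m ≤ X  iff  m^t' ≤ C^t' · n^(2t' - 1).
ExBound : (r t n C t' : ℕ) → Set
ExBound r t n C t' = ∃ λ m → ExAdmissible r t n m × (m ^ t' ≤ (C ^ t') * (n ^ (2 * t' ∸ 1)))

{-# OPTIONS --safe #-}
module Submission where

-- Dependent random choice gives, for every colour a, a large set U a all of whose t'-subsets have many
-- common neighbours in colour a.  A greedy Ramsey argument passes to disjoint A a ⊆ U a of size t' that
-- are homogeneous inside and between each other.  Take B b among the common neighbours of A b, first so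
-- that every vertex of every A a sees B b in a single colour, then again homogeneous.  A vertex of A a
-- now has one of r ^ (r ∸ 1) types (its colours towards the B b with b ≢ a), so t of the t' vertices have
-- the same type.  The resulting 2r blocks show all colours, and a minimal subfamily that still shows
-- all colours is a member of the family.

open import Defs
open import Data.Nat
open import Data.Nat.ListAction using (sum)
open import Data.Nat.Properties
open import Data.Nat.Tactic.RingSolver using (solve-∀)
open import Data.Bool using (true; false; if_then_else_)
open import Data.Fin using (Fin; zero; suc; _↑ˡ_; _↑ʳ_; combine; remQuot; quotient; punchIn; punchOut; cast; splitAt; join; toℕ)
import Data.Fin.Properties as Fin
open import Data.List using (List; []; _∷_; _++_; map; length; filter; allFin; take; lookup; concatMap; cartesianProduct; cartesianProductWith)
open import Data.List.Properties using (length-tabulate; filter-all; filter-some; length-map; length-++; length-take; map-tabulate)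
open import Data.List.Membership.Propositional using (_∈_; _∉_; lose)
open import Data.List.Membership.Propositional.Properties using (∈-allFin; ∈-cartesianProductWith⁺; ∈-filter⁺; ∈-filter⁻; ∈-map⁺; ∈-lookup; ∈-concatMap⁺)
open import Data.List.Relation.Binary.Sublist.Propositional as Sublist using (_⊆_; ⊆-refl; ⊆-trans; []; _∷_; _∷ʳ_; minimum)
open import Data.List.Relation.Binary.Sublist.Propositional.Properties using (filter-⊆; All-resp-⊆; take-⊆)
open import Data.List.Relation.Unary.Any using (here; there)
open import Data.List.Relation.Unary.All as All using (All; []; _∷_)
import Data.List.Relation.Unary.All.Properties as All
open import Data.List.Relation.Unary.AllPairs using (AllPairs; []; _∷_)
open import Data.List.Relation.Unary.Unique.Propositional using (Unique)
import Data.List.Relation.Unary.Unique.Propositional.Properties as Unique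
open import Data.Vec using (Vec; []; _∷_; head; fromList)
import Data.Vec.Relation.Unary.All as Vec
open import Data.Vec.Relation.Unary.All.Properties using (fromList⁺; fromList⁻)
open import Data.Product using (Σ; ∃; _×_; _,_; proj₁; proj₂; uncurry)
open import Data.Product.Properties using (≡-dec)
open import Data.Sum using (_⊎_; inj₁; inj₂; [_,_]′)
open import Data.Unit using (⊤; tt)
open import Function using (_∘_; id)
open import Function.Definitions using (Injective)
open import Relation.Binary.Definitions using (DecidableEquality)
open import Relation.Unary using (Pred; Decidable)
open import Relation.Nullary using (¬_; Dec; yes; no; does; contradiction; ¬?)
open import Relation.Nullary.Decidable using (_×-dec_; map′)
open import Relation.Binary.PropositionalEquality using (_≡_; _≢_; refl; sym; trans; cong; cong₂; subst; subst₂; ≢-sym; module ≡-Reasoning)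

-- Finite sums over lists and indicators of decidable propositions.

private variable
  A B : Set
  P Q : Set

∑ : List A → (A → ℕ) → ℕ
∑ xs f = sum (map f xs)

∑-cong : (xs : List A) {f g : A → ℕ} → (∀ x → f x ≡ g x) → ∑ xs f ≡ ∑ xs g
∑-cong []       f≡g = refl
∑-cong (x ∷ xs) f≡g = cong₂ _+_ (f≡g x) (∑-cong xs f≡g)

∑-mono : (xs : List A) {f g : A → ℕ} → (∀ x → f x ≤ g x) → ∑ xs f ≤ ∑ xs g
∑-mono []       f≤g = z≤n
∑-mono (x ∷ xs) f≤g = +-mono-≤ (f≤g x) (∑-mono xs f≤g)

∑-const : (xs : List A) (k : ℕ) → ∑ xs (λ _ → k) ≡ length xs * k
∑-const []       k = refl
∑-const (x ∷ xs) k = cong (k +_) (∑-const xs k)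

+-interchange : ∀ a b c d → (a + b) + (c + d) ≡ (a + c) + (b + d)
+-interchange = solve-∀

∑-+ : (xs : List A) (f g : A → ℕ) → ∑ xs (λ x → f x + g x) ≡ ∑ xs f + ∑ xs g
∑-+ []       f g = refl
∑-+ (x ∷ xs) f g = trans (cong (f x + g x +_) (∑-+ xs f g)) (+-interchange (f x) (g x) (∑ xs f) (∑ xs g))

∑-*ˡ : (xs : List A) (k : ℕ) (f : A → ℕ) → ∑ xs (λ x → k * f x) ≡ k * ∑ xs f
∑-*ˡ []       k f = sym (*-zeroʳ k)
∑-*ˡ (x ∷ xs) k f = trans (cong (k * f x +_) (∑-*ˡ xs k f)) (sym (*-distribˡ-+ k (f x) (∑ xs f)))

∑-*ʳ : (xs : List A) (k : ℕ) (f : A → ℕ) → ∑ xs (λ x → f x * k) ≡ ∑ xs f * k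
∑-*ʳ xs k f = trans (∑-cong xs (λ x → *-comm (f x) k)) (trans (∑-*ˡ xs k f) (*-comm k (∑ xs f)))

∑-swap : (xs : List A) (ys : List B) (f : A → B → ℕ) →
  ∑ xs (λ x → ∑ ys (f x)) ≡ ∑ ys (λ y → ∑ xs (λ x → f x y))
∑-swap []       ys f = sym (trans (∑-const ys 0) (*-zeroʳ (length ys)))
∑-swap (x ∷ xs) ys f = trans (cong (∑ ys (f x) +_) (∑-swap xs ys f)) (sym (∑-+ ys (f x) _))

∑-++ : (xs ys : List A) (f : A → ℕ) → ∑ (xs ++ ys) f ≡ ∑ xs f + ∑ ys f
∑-++ []       ys f = refl
∑-++ (x ∷ xs) ys f = trans (cong (f x +_) (∑-++ xs ys f)) (sym (+-assoc (f x) _ _))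

∑-map : (xs : List A) (h : A → B) (f : B → ℕ) → ∑ (map h xs) f ≡ ∑ xs (f ∘ h)
∑-map []       h f = refl
∑-map (x ∷ xs) h f = cong (f (h x) +_) (∑-map xs h f)

∑-cartesianProductWith : ∀ {C : Set} (h : A → B → C) (xs : List A) (ys : List B) (f : C → ℕ) →
  ∑ (cartesianProductWith h xs ys) f ≡ ∑ xs (λ x → ∑ ys (λ y → f (h x y)))
∑-cartesianProductWith h []       ys f = refl
∑-cartesianProductWith h (x ∷ xs) ys f =
  trans (∑-++ (map (h x) ys) _ f) (cong₂ _+_ (∑-map ys (h x) f) (∑-cartesianProductWith h xs ys f))

length-cartesianProductWith : ∀ {C : Set} (h : A → B → C) (xs : List A) (ys : List B) →
  length (cartesianProductWith h xs ys) ≡ length xs * length ys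
length-cartesianProductWith h []       ys = refl
length-cartesianProductWith h (x ∷ xs) ys =
  trans (length-++ (map (h x) ys)) (cong₂ _+_ (length-map (h x) ys) (length-cartesianProductWith h xs ys))

∑-<⇒∃ : (xs : List A) (f g : A → ℕ) → ∑ xs f < ∑ xs g → ∃ λ x → f x < g x
∑-<⇒∃ (x ∷ xs) f g lt with f x <? g x
... | yes fx<gx = x , fx<gx
... | no  fx≮gx = ∑-<⇒∃ xs f g (+-cancelˡ-< (g x) _ _ (≤-<-trans (+-monoˡ-≤ _ (≮⇒≥ fx≮gx)) lt))

ind : Dec P → ℕ
ind d = if does d then 1 else 0

ind-cong : (d : Dec P) (e : Dec Q) → (P → Q) → (Q → P) → ind d ≡ ind e
ind-cong (yes p) (yes q) to from = refl
ind-cong (yes p) (no ¬q) to from = contradiction (to p) ¬q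
ind-cong (no ¬p) (yes q) to from = contradiction (from q) ¬p
ind-cong (no ¬p) (no ¬q) to from = refl

ind-× : (d : Dec P) (e : Dec Q) → ind (d ×-dec e) ≡ ind d * ind e
ind-× (yes p) (yes q) = refl
ind-× (yes p) (no ¬q) = refl
ind-× (no ¬p) e       = refl

∑-ind-×-≤ : {Q : A → Set} (xs : List A) (d : Dec P) (e : Decidable Q) {b : ℕ} →
  (P → ∑ xs (λ x → ind (e x)) ≤ b) → ∑ xs (λ x → ind (d ×-dec e x)) ≤ b
∑-ind-×-≤ xs (yes p) e bound = bound p
∑-ind-×-≤ xs (no ¬p) e bound =
  ≤-trans (≤-reflexive (trans (∑-const xs 0) (*-zeroʳ (length xs)))) z≤n

length-filter-∑ : {P : Pred A _} (P? : Decidable P) (xs : List A) →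
  length (filter P? xs) ≡ ∑ xs (λ x → ind (P? x))
length-filter-∑ P? []       = refl
length-filter-∑ P? (x ∷ xs) with does (P? x)
... | true  = cong suc (length-filter-∑ P? xs)
... | false = length-filter-∑ P? xs

-- The power mean inequality over the natural numbers.

-- (x − y)(xᵏ − yᵏ) ≥ 0, with both sides moved so that no subtraction occurs.
rearrangement : ∀ x y k → x * y ^ k + x ^ k * y ≤ x ^ suc k + y ^ suc k
rearrangement x y k = by-order (≤-total x y)
  where
  expand : ∀ x d w e → x * (w + e) + w * (x + d) + d * e ≡ x * w + (x + d) * (w + e)
  expand = solve-∀
  swap-left : ∀ x y v w → y * v + w * x ≡ x * w + v * y
  swap-left = solve-∀
  general : ∀ {x y w z} → x ≤ y → w ≤ z → x * z + w * y ≤ x * w + y * z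
  general {x} {y} {w} {z} x≤y w≤z
    rewrite sym (m+[n∸m]≡n x≤y) | sym (m+[n∸m]≡n w≤z)
    = ≤-trans (m≤m+n _ ((y ∸ x) * (z ∸ w))) (≤-reflexive (expand x (y ∸ x) w (z ∸ w)))
  by-order : x ≤ y ⊎ y ≤ x → x * y ^ k + x ^ k * y ≤ x ^ suc k + y ^ suc k
  by-order (inj₁ x≤y) = general x≤y (^-monoˡ-≤ k x≤y)
  by-order (inj₂ y≤x) = subst₂ _≤_ (swap-left x y (x ^ k) (y ^ k)) (+-comm (y ^ suc k) (x ^ suc k))
    (general y≤x (^-monoˡ-≤ k y≤x))

-- Chebyshev's sum inequality for the similarly ordered families `f` and `f ^ k`. In the induction,
-- the cross terms between the new entry and each old one are bounded by `rearrangement`.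
chebyshev : (xs : List A) (f : A → ℕ) (k : ℕ) →
  ∑ xs f * ∑ xs (λ x → f x ^ k) ≤ length xs * ∑ xs (λ x → f x ^ suc k)
chebyshev []       f k = z≤n
chebyshev (x ∷ xs) f k = begin
  (f x + S) * (f x ^ k + Sₖ)
    ≡⟨ expand (f x) S (f x ^ k) Sₖ ⟩
  f x ^ suc k + (f x * Sₖ + f x ^ k * S) + S * Sₖ
    ≤⟨ +-mono-≤ (+-monoʳ-≤ (f x ^ suc k) cross) (chebyshev xs f k) ⟩
  f x ^ suc k + (length xs * f x ^ suc k + Sₛ) + length xs * Sₛ
    ≡⟨ collect (f x ^ suc k) (length xs) Sₛ ⟩
  suc (length xs) * (f x ^ suc k + Sₛ) ∎
  where
  open ≤-Reasoning
  S Sₖ Sₛ : ℕ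
  S  = ∑ xs f
  Sₖ = ∑ xs (λ y → f y ^ k)
  Sₛ = ∑ xs (λ y → f y ^ suc k)
  expand : ∀ a b c d → (a + b) * (c + d) ≡ a * c + (a * d + c * b) + b * d
  expand = solve-∀
  collect : ∀ a l b → a + (l * a + b) + l * b ≡ (1 + l) * (a + b)
  collect = solve-∀
  cross : f x * Sₖ + f x ^ k * S ≤ length xs * f x ^ suc k + Sₛ
  cross = begin
    f x * Sₖ + f x ^ k * S
      ≡⟨ cong₂ _+_ (∑-*ˡ xs (f x) _) (∑-*ˡ xs (f x ^ k) f) ⟨
    ∑ xs (λ y → f x * f y ^ k) + ∑ xs (λ y → f x ^ k * f y)
      ≡⟨ ∑-+ xs _ _ ⟨
    ∑ xs (λ y → f x * f y ^ k + f x ^ k * f y)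
      ≤⟨ ∑-mono xs (λ y → rearrangement (f x) (f y) k) ⟩
    ∑ xs (λ y → f x ^ suc k + f y ^ suc k)
      ≡⟨ ∑-+ xs _ _ ⟩
    ∑ xs (λ _ → f x ^ suc k) + Sₛ
      ≡⟨ cong (_+ Sₛ) (∑-const xs _) ⟩
    length xs * f x ^ suc k + Sₛ ∎

-- Jensen's inequality for a power, cleared of denominators. Each induction step on the exponent
-- absorbs one more factor of the sum by `chebyshev`, at the cost of one factor `length xs`.
power-mean : (xs : List A) (f : A → ℕ) (k : ℕ) →
  ∑ xs f ^ suc k ≤ length xs ^ k * ∑ xs (λ x → f x ^ suc k)
power-mean xs f zero = ≤-reflexive (begin
  ∑ xs f * 1                   ≡⟨ *-identityʳ _ ⟩
  ∑ xs f                       ≡⟨ ∑-cong xs (λ x → *-identityʳ (f x)) ⟨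
  ∑ xs (λ x → f x ^ 1)         ≡⟨ +-identityʳ _ ⟨
  1 * ∑ xs (λ x → f x ^ 1)     ∎)
  where open ≡-Reasoning
power-mean xs f (suc k) = begin
  S * S ^ suc k                        ≤⟨ *-monoʳ-≤ S (power-mean xs f k) ⟩
  S * (length xs ^ k * Sₖ)             ≡⟨ left-commute S (length xs ^ k) Sₖ ⟩
  length xs ^ k * (S * Sₖ)             ≤⟨ *-monoʳ-≤ (length xs ^ k) (chebyshev xs f (suc k)) ⟩
  length xs ^ k * (length xs * Sₛ)     ≡⟨ regroup (length xs ^ k) (length xs) Sₛ ⟩
  length xs ^ suc k * Sₛ               ∎
  where
  open ≤-Reasoning
  S Sₖ Sₛ : ℕ
  S  = ∑ xs f
  Sₖ = ∑ xs (λ y → f y ^ suc k)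
  Sₛ = ∑ xs (λ y → f y ^ suc (suc k))
  left-commute : ∀ a b c → a * (b * c) ≡ b * (a * c)
  left-commute = solve-∀
  regroup : ∀ a b c → a * (b * c) ≡ b * a * c
  regroup = solve-∀

-- Sublists, deletion of entries, and exchange of quantifiers.

AllPairs-resp-⊆ : ∀ {R : A → A → Set} {xs ys} → xs ⊆ ys → AllPairs R ys → AllPairs R xs
AllPairs-resp-⊆ []         []       = []
AllPairs-resp-⊆ (y ∷ʳ τ)   (r ∷ rs) = AllPairs-resp-⊆ τ rs
AllPairs-resp-⊆ (refl ∷ τ) (r ∷ rs) = All-resp-⊆ τ r ∷ AllPairs-resp-⊆ τ rs

module _ (_≟_ : DecidableEquality A) where

  _≢?_ : ∀ v → Decidable (v ≢_)
  v ≢? x = ¬? (v ≟ x)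

  length-remove₁ : ∀ v {xs : List A} → Unique xs →
    length xs ≤ suc (length (filter (v ≢?_) xs))
  length-remove₁ v {[]}     []       = z≤n
  length-remove₁ v {x ∷ xs} (x∉ ∷ u) with v ≟ x
  ... | yes refl = s≤s (≤-reflexive (sym (cong length (filter-all (v ≢?_) x∉))))
  ... | no  _    = s≤s (length-remove₁ v u)

  -- The deletion step of dependent random choice. As `xs` has no repetitions, each entry of `zs`
  -- costs at most one entry of `xs`.
  remove : (zs xs : List A) → Unique xs →
    ∃ λ ys → ys ⊆ xs × length xs ≤ length zs + length ys × All (_∉ zs) ys
  remove []       xs u = xs , ⊆-refl , ≤-refl , All.tabulate (λ _ ())
  remove (z ∷ zs) xs u
    with ys , τ , len , avoid ← remove zs (filter (z ≢?_) xs) (Unique.filter⁺ (z ≢?_) u)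
    = ys , ⊆-trans τ (filter-⊆ (z ≢?_) xs) ,
      ≤-trans (length-remove₁ z u) (s≤s len) ,
      All.zipWith (λ where (z≢y , y∉) (here refl) → z≢y refl
                           (z≢y , y∉) (there y∈)  → y∉ y∈)
                  (All-resp-⊆ τ (All.all-filter (z ≢?_) xs) , avoid)

Vec-All-exchange : ∀ {p q} {S : Vec A p} {T : Vec B q} {Q : A → B → Set} →
  Vec.All (λ u → Vec.All (Q u) T) S → Vec.All (λ x → Vec.All (λ u → Q u x) S) T
Vec-All-exchange {T = []}    rs = Vec.[]
Vec-All-exchange {T = x ∷ T} rs = Vec.map Vec.head rs Vec.∷ Vec-All-exchange (Vec.map Vec.tail rs)

-- Dependent random choice, with expectations written as sums over all tuples.

module DependentRandomChoice {n : ℕ} {R : Fin n → Fin n → Set} (R? : ∀ u v → Dec (R u v)) where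

  V : List (Fin n)
  V = allFin n

  length-V : length V ≡ n
  length-V = length-tabulate id

  -- The sample space. Repetitions are allowed, so that the number of tuples whose entries all
  -- satisfy a predicate is an exact power, as `∑-tuples-all` shows.
  tuples : ∀ s → List (Vec (Fin n) s)
  tuples zero    = [] ∷ []
  tuples (suc s) = cartesianProductWith _∷_ V (tuples s)

  ∈-tuples : ∀ {s} (T : Vec (Fin n) s) → T ∈ tuples s
  ∈-tuples []      = here refl
  ∈-tuples (x ∷ T) = ∈-cartesianProductWith⁺ _∷_ (∈-allFin x) (∈-tuples T)

  ∑-tuples-all : ∀ {P : Fin n → Set} (P? : Decidable P) s →
    ∑ (tuples s) (λ T → ind (Vec.all? P? T)) ≡ ∑ V (λ x → ind (P? x)) ^ s
  ∑-tuples-all P? zero    = refl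
  ∑-tuples-all P? (suc s) = begin
    ∑ (tuples (suc s)) (λ T → ind (Vec.all? P? T))
      ≡⟨ ∑-cartesianProductWith _∷_ V (tuples s) _ ⟩
    ∑ V (λ x → ∑ (tuples s) (λ T → ind (P? x ×-dec Vec.all? P? T)))
      ≡⟨ ∑-cong V (λ x → trans (∑-cong (tuples s) (λ T → ind-× (P? x) (Vec.all? P? T)))
                               (∑-*ˡ (tuples s) (ind (P? x)) _)) ⟩
    ∑ V (λ x → ind (P? x) * ∑ (tuples s) (λ T → ind (Vec.all? P? T)))
      ≡⟨ ∑-*ʳ V _ _ ⟩
    ∑ V (λ x → ind (P? x)) * ∑ (tuples s) (λ T → ind (Vec.all? P? T))
      ≡⟨ cong (∑ V (λ x → ind (P? x)) *_) (∑-tuples-all P? s) ⟩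
    ∑ V (λ x → ind (P? x)) ^ suc s ∎
    where open ≡-Reasoning

  length-tuples : ∀ s → length (tuples s) ≡ n ^ s
  length-tuples zero    = refl
  length-tuples (suc s) = trans (length-cartesianProductWith _∷_ V (tuples s)) (cong₂ _*_ length-V (length-tuples s))

  common : ∀ {s} → Vec (Fin n) s → List (Fin n)
  common S = filter (λ x → Vec.all? (λ u → R? u x) S) V

  cocommon? : ∀ {s} (T : Vec (Fin n) s) → Decidable (λ u → Vec.All (R u) T)
  cocommon? T u = Vec.all? (R? u) T

  common-neighbours : ∀ {p M} {U : List (Fin n)} →
    (∀ S → Vec.All (_∈ U) S → M ≤ length (common {p} S)) →
    ∀ xs → length xs ≡ p → All (_∈ U) xs →
    ∃ λ ys → Unique ys × M ≤ length ys × All (λ x → All (R x) ys) xs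
  common-neighbours rich xs refl xs⊆U = common S , Unique.filter⁺ _ (Unique.allFin⁺ n) ,
    rich S (fromList⁺ xs⊆U) ,
    All.tabulate λ x∈ → All.tabulate λ y∈ →
      All.lookup (fromList⁻ (proj₂ (∈-filter⁻ (λ x → Vec.all? (λ u → R? u x) S) {xs = V} y∈))) x∈
    where S = fromList xs

  module _ (k M a : ℕ) where
    private s = suc k

    Bad : Vec (Fin n) s → Set
    Bad S = length (common S) < M

    -- The second component says that all entries of `S` lie in `U₀ T`, so `bads T` lists the bad
    -- tuples inside the set that `T` selects.
    BadIn : Vec (Fin n) s → Vec (Fin n) s → Set
    BadIn T S = Bad S × Vec.All (λ u → Vec.All (R u) T) S

    BadIn? : ∀ T → Decidable (BadIn T)
    BadIn? T S = (length (common S) <? M) ×-dec Vec.all? (cocommon? T) S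

    U₀ : Vec (Fin n) s → List (Fin n)
    U₀ T = filter (cocommon? T) V

    bads : Vec (Fin n) s → List (Vec (Fin n) s)
    bads T = filter (BadIn? T) (tuples s)

    -- Double counting: `u` is in `U₀ T` exactly when every entry of `T` is an out-neighbour of `u`,
    -- so `u` is counted once for each `s`-tuple of its out-neighbours.
    ∑-U₀ : ∑ (tuples s) (λ T → length (U₀ T)) ≡ ∑ V (λ u → ∑ V (λ v → ind (R? u v)) ^ s)
    ∑-U₀ = begin
      ∑ (tuples s) (λ T → length (U₀ T))
        ≡⟨ ∑-cong (tuples s) (λ T → length-filter-∑ (cocommon? T) V) ⟩
      ∑ (tuples s) (λ T → ∑ V (λ u → ind (cocommon? T u)))
        ≡⟨ ∑-swap (tuples s) V _ ⟩
      ∑ V (λ u → ∑ (tuples s) (λ T → ind (cocommon? T u)))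
        ≡⟨ ∑-cong V (λ u → ∑-tuples-all (R? u) s) ⟩
      ∑ V (λ u → ∑ V (λ v → ind (R? u v)) ^ s) ∎
      where open ≡-Reasoning

    -- A tuple `S` lies inside `U₀ T` exactly when every entry of `T` is a common neighbour of `S`.
    -- A bad `S` has fewer than `M` of these to fill the `s` places of `T`.
    ∑-BadIn : ∀ S → ∑ (tuples s) (λ T → ind (BadIn? T S)) ≤ M ^ s
    ∑-BadIn S = ∑-ind-×-≤ (tuples s) (length (common S) <? M) (λ T → Vec.all? (cocommon? T) S) λ bad → begin
      ∑ (tuples s) (λ T → ind (Vec.all? (cocommon? T) S))
        ≡⟨ ∑-cong (tuples s) (λ T → ind-cong (Vec.all? (cocommon? T) S)
             (Vec.all? (λ x → Vec.all? (λ u → R? u x) S) T) Vec-All-exchange Vec-All-exchange) ⟩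
      ∑ (tuples s) (λ T → ind (Vec.all? (λ x → Vec.all? (λ u → R? u x) S) T))
        ≡⟨ ∑-tuples-all _ s ⟩
      ∑ V (λ x → ind (Vec.all? (λ u → R? u x) S)) ^ s
        ≡⟨ cong (_^ s) (length-filter-∑ _ V) ⟨
      length (common S) ^ s
        ≤⟨ ^-monoˡ-≤ s (<⇒≤ bad) ⟩
      M ^ s ∎
      where open ≤-Reasoning

    ∑-bads : ∑ (tuples s) (λ T → length (bads T)) ≤ n ^ s * M ^ s
    ∑-bads = begin
      ∑ (tuples s) (λ T → length (bads T))
        ≡⟨ ∑-cong (tuples s) (λ T → length-filter-∑ (BadIn? T) (tuples s)) ⟩
      ∑ (tuples s) (λ T → ∑ (tuples s) (λ S → ind (BadIn? T S)))
        ≡⟨ ∑-swap (tuples s) (tuples s) _ ⟩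
      ∑ (tuples s) (λ S → ∑ (tuples s) (λ T → ind (BadIn? T S)))
        ≤⟨ ∑-mono (tuples s) ∑-BadIn ⟩
      ∑ (tuples s) (λ _ → M ^ s)
        ≡⟨ ∑-const (tuples s) _ ⟩
      length (tuples s) * M ^ s
        ≡⟨ cong (_* M ^ s) (length-tuples s) ⟩
      n ^ s * M ^ s ∎
      where open ≤-Reasoning

    -- With e related pairs, convexity bounds the mean size of `U₀ T` below by e ^ s / n ^ (2s - 1),
    -- and `M ^ s` bounds the mean number of bad tuples. The condition says that the first exceeds
    -- the second by more than `a`; here `s + k` is 2s - 1.
    Dense : Set
    Dense = (a + M ^ s) * n ^ (s + k) < ∑ V (λ u → ∑ V (λ v → ind (R? u v))) ^ s

    -- First moment argument: the two totals over all `T` are compared after multiplication by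
    -- `n ^ k`, which is the factor that `power-mean` produces.
    ∃-good-T : Dense → ∃ λ T → a + length (bads T) < length (U₀ T)
    ∃-good-T dense = ∑-<⇒∃ (tuples s) _ _ (*-cancelˡ-< (n ^ k) _ _ (begin-strict
      n ^ k * ∑ (tuples s) (λ T → a + length (bads T))
        ≡⟨ cong (n ^ k *_) (trans (∑-+ (tuples s) _ _)
             (cong (_+ ∑ (tuples s) (λ T → length (bads T))) (trans (∑-const (tuples s) a) (cong (_* a) (length-tuples s))))) ⟩
      n ^ k * (n ^ s * a + ∑ (tuples s) (λ T → length (bads T)))
        ≤⟨ *-monoʳ-≤ (n ^ k) (+-monoʳ-≤ (n ^ s * a) ∑-bads) ⟩
      n ^ k * (n ^ s * a + n ^ s * M ^ s)
        ≡⟨ regroup (n ^ k) (n ^ s) a (M ^ s) ⟩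
      (a + M ^ s) * (n ^ s * n ^ k)
        ≡⟨ cong ((a + M ^ s) *_) (^-distribˡ-+-* n s k) ⟨
      (a + M ^ s) * n ^ (s + k)
        <⟨ dense ⟩
      ∑ V (λ u → ∑ V (λ v → ind (R? u v))) ^ s
        ≤⟨ power-mean V _ k ⟩
      length V ^ k * ∑ V (λ u → ∑ V (λ v → ind (R? u v)) ^ s)
        ≡⟨ cong₂ _*_ (cong (_^ k) length-V) (sym ∑-U₀) ⟩
      n ^ k * ∑ (tuples s) (λ T → length (U₀ T)) ∎))
      where
      open ≤-Reasoning
      regroup : ∀ x y a b → x * (y * a + y * b) ≡ (a + b) * (y * x)
      regroup = solve-∀

    -- Deleting the first entry of every bad tuple from `U₀ T` leaves at least `a` vertices. A bad
    -- tuple inside what remains would be listed in `bads T`, so its head would have been deleted.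
    dependent-random-choice : Dense →
      ∃ λ U → Unique U × a ≤ length U × (∀ xs → length xs ≡ s → All (_∈ U) xs →
        ∃ λ ys → Unique ys × M ≤ length ys × All (λ x → All (R x) ys) xs)
    dependent-random-choice dense with T , big ← ∃-good-T dense
      with U , τ , len , avoid ← remove Fin._≟_ (map head (bads T)) (U₀ T)
             (Unique.filter⁺ (cocommon? T) (Unique.allFin⁺ n))
      = U , AllPairs-resp-⊆ τ (Unique.filter⁺ (cocommon? T) (Unique.allFin⁺ n)) , long , common-neighbours rich
      where
      long : a ≤ length U
      long = +-cancelˡ-≤ (length (bads T)) _ _ (begin
        length (bads T) + a                       ≡⟨ +-comm _ a ⟩
        a + length (bads T)                       ≤⟨ <⇒≤ big ⟩
        length (U₀ T)                             ≤⟨ len ⟩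
        length (map head (bads T)) + length U     ≡⟨ cong (_+ length U) (length-map head (bads T)) ⟩
        length (bads T) + length U                ∎)
        where open ≤-Reasoning
      rich : ∀ S → Vec.All (_∈ U) S → M ≤ length (common S)
      rich S S⊆U = ≮⇒≥ λ bad →
        All.lookup avoid (headIn S⊆U)
          (∈-map⁺ head (∈-filter⁺ (BadIn? T) (∈-tuples S)
            (bad , Vec.map (λ u∈U → proj₂ (∈-filter⁻ (cocommon? T) {xs = V} (Sublist.lookup τ u∈U))) S⊆U)))
        where
        headIn : ∀ {S : Vec (Fin n) s} → Vec.All (_∈ U) S → head S ∈ U
        headIn (px Vec.∷ _) = px

-- Pigeonhole principles for colourings of lists.

takeExactly : ∀ s (xs : List A) → s ≤ length xs → ∃ λ ys → ys ⊆ xs × length ys ≡ s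
takeExactly s xs s≤ = take s xs , take-⊆ s xs , trans (length-take s xs) (m≤n⇒m⊓n≡m s≤)

module _ {ρ : ℕ} where
  private r = suc ρ

  -- Every entry is counted at least once, in the class of its own colour.
  colour-classes-cover : (f : A → Fin r) (xs : List A) →
    length xs ≤ ∑ (allFin r) (λ κ → length (filter (λ x → f x Fin.≟ κ) xs))
  colour-classes-cover f xs = begin
    length xs
      ≡⟨ *-identityʳ _ ⟨
    length xs * 1
      ≡⟨ ∑-const xs 1 ⟨
    ∑ xs (λ _ → 1)
      ≤⟨ ∑-mono xs (λ x → ≤-trans (filter-some (f x Fin.≟_) (∈-allFin (f x)))
                                  (≤-reflexive (length-filter-∑ (f x Fin.≟_) (allFin r)))) ⟩
    ∑ xs (λ x → ∑ (allFin r) (λ κ → ind (f x Fin.≟ κ)))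
      ≡⟨ ∑-swap xs (allFin r) _ ⟩
    ∑ (allFin r) (λ κ → ∑ xs (λ x → ind (f x Fin.≟ κ)))
      ≡⟨ ∑-cong (allFin r) (λ κ → length-filter-∑ (λ x → f x Fin.≟ κ) xs) ⟨
    ∑ (allFin r) (λ κ → length (filter (λ x → f x Fin.≟ κ) xs)) ∎
    where open ≤-Reasoning

  largeClass : (f : A → Fin r) (s : ℕ) (xs : List A) → s * r ≤ length xs →
    ∃ λ κ → s ≤ length (filter (λ x → f x Fin.≟ κ) xs)
  -- Any colour serves here; `zero` exists because the number of colours is a successor.
  largeClass f zero    xs len = zero , z≤n
  -- If every class had at most `s` entries, the total would be at most `s * r`, which is less than
  -- `suc s * r`.
  largeClass f (suc s) xs len = ∑-<⇒∃ (allFin r) (λ _ → s) _ (begin-strict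
    ∑ (allFin r) (λ _ → s)   ≡⟨ ∑-const (allFin r) s ⟩
    length (allFin r) * s    ≡⟨ cong (_* s) (length-tabulate {n = r} id) ⟩
    r * s                    ≡⟨ *-comm r s ⟩
    s * r                    <⟨ m<n+m (s * r) z<s ⟩
    suc s * r                ≤⟨ len ⟩
    length xs                ≤⟨ colour-classes-cover f xs ⟩
    _                        ∎)
    where open ≤-Reasoning

  pigeonhole : (f : A → Fin r) (s : ℕ) (xs : List A) → s * r ≤ length xs →
    ∃ λ κ → ∃ λ ys → ys ⊆ xs × length ys ≡ s × All (λ x → f x ≡ κ) ys
  pigeonhole f s xs len
    with κ , big ← largeClass f s xs len
    with ys , τ , leny ← takeExactly s (filter (λ x → f x Fin.≟ κ) xs) big
    = κ , ys , ⊆-trans τ (filter-⊆ (λ x → f x Fin.≟ κ) xs) , leny ,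
      All-resp-⊆ τ (All.all-filter (λ x → f x Fin.≟ κ) xs)

  -- One application of `pigeonhole` per function, each costing a factor `r`.
  pigeonholes : ∀ q (f : Fin q → A → Fin r) (s : ℕ) (xs : List A) → s * r ^ q ≤ length xs →
    ∃ λ ys → ys ⊆ xs × length ys ≡ s × (∀ j → ∃ λ κ → All (λ x → f j x ≡ κ) ys)
  pigeonholes zero f s xs len
    with ys , τ , leny ← takeExactly s xs (≤-trans (≤-reflexive (sym (*-identityʳ s))) len)
    = ys , τ , leny , λ ()
  pigeonholes (suc q) f s xs len
    with κ , ys , τ , leny , mono ← pigeonhole (f zero) (s * r ^ q) xs
           (≤-trans (≤-reflexive (trans (*-assoc s (r ^ q) r) (cong (s *_) (*-comm (r ^ q) r)))) len)
    with zs , σ , lenz , monos ← pigeonholes q (f ∘ suc) s ys (≤-reflexive (sym leny))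
    = zs , ⊆-trans σ τ , lenz ,
      λ where zero    → κ , All-resp-⊆ σ mono
              (suc j) → monos j

-- Greedy Ramsey arguments for several lists at once.

nonempty : ∀ {N} (xs : List A) → length xs ≡ suc N → ∃ (_∈ xs)
nonempty (x ∷ xs) _ = x , here refl

-- Each of the `m` vertices costs one place, as it may itself be in the list, and a factor `r` for
-- the choice of its majority colour.
shrinkBound : (r m s : ℕ) → ℕ
shrinkBound r zero    s = s
shrinkBound r (suc m) s = suc (shrinkBound r m s * r)

-- The base value leaves room for an anchor. In the step, one `suc` pays for the vertex picked from
-- the head of the list and the other is the one that `shrink₁` asks for.
picksBound : (r M N : ℕ) → ℕ
picksBound r zero    N = suc N
picksBound r (suc M) N = suc (suc (picksBound r M N * r))

-- From the first list, `s * r ^ suc q` vertices are picked, since each has `suc q` colours to be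
-- made equal: one towards its own list and one towards each of the `q` others.
homogeniseBound : (r q s : ℕ) → ℕ
homogeniseBound r zero    s = 0
homogeniseBound r (suc q) s = picksBound r (s * r ^ suc q) (homogeniseBound r q s)

module Ramsey {n ρ : ℕ} (c : EdgeColoring n (suc ρ)) (c-sym : Symmetric c) where
  private
    r = suc ρ
    Vertex = Fin n

  -- The diagonal values of `c` carry no meaning, so distinctness is built in. Hence `Edges` also
  -- records that two lists are disjoint, and the final embedding gets its injectivity from here.
  Edge : Fin r → Vertex → Vertex → Set
  Edge κ x y = x ≢ y × c x y ≡ κ

  Edge-sym : ∀ {κ x y} → Edge κ x y → Edge κ y x
  Edge-sym {x = x} {y} (x≢y , cxy) = ≢-sym x≢y , trans (c-sym y x) cxy

  Edges : Fin r → List Vertex → List Vertex → Set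
  Edges κ xs ys = All (λ x → All (Edge κ x) ys) xs

  Edges-sym : ∀ {κ xs ys} → Edges κ xs ys → Edges κ ys xs
  Edges-sym es = All.tabulate λ y∈ → All.tabulate λ x∈ →
    Edge-sym (All.lookup (All.lookup es x∈) y∈)

  Edges-⊆ : ∀ {κ xs xs′ ys ys′} → xs′ ⊆ xs → ys′ ⊆ ys → Edges κ xs ys → Edges κ xs′ ys′
  Edges-⊆ τ σ es = All.map (All-resp-⊆ σ) (All-resp-⊆ τ es)

  -- Names the common colour as a function of `v` once `w` is fixed, so that the pigeonhole
  -- principle can later be applied to that function.
  reanchor : ∀ {κ v w ys} → w ∈ ys → All (Edge κ v) ys → All (Edge (c v w) v) ys
  reanchor w∈ es = All.map (λ (v≢y , cvy) → v≢y , trans cvy (sym (proj₂ (All.lookup es w∈)))) es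

  shrink₁ : ∀ v s {xs} → Unique xs → suc (s * r) ≤ length xs →
    ∃ λ κ → ∃ λ ys → ys ⊆ xs × length ys ≡ s × All (Edge κ v) ys
  shrink₁ v s {xs} u len
    with κ , ys , τ , leny , mono ← pigeonhole (c v) s (filter (_≢?_ Fin._≟_ v) xs)
           (s≤s⁻¹ (≤-trans len (length-remove₁ Fin._≟_ v u)))
    = κ , ys , ⊆-trans τ (filter-⊆ (_≢?_ Fin._≟_ v) xs) , leny ,
      All.zip (All-resp-⊆ τ (All.all-filter (_≢?_ Fin._≟_ v) xs) , mono)

  -- The vertices are treated one after another. The colour may depend on the vertex, and passing to
  -- further sublists preserves the colours already fixed.
  shrink : ∀ vs s {xs} → Unique xs → shrinkBound r (length vs) s ≤ length xs →
    ∃ λ ys → ys ⊆ xs × length ys ≡ s × All (λ v → ∃ λ κ → All (Edge κ v) ys) vs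
  shrink [] s {xs} u len with ys , τ , leny ← takeExactly s xs len = ys , τ , leny , []
  shrink (v ∷ vs) s u len
    with κ , ys , τ , leny , mono ← shrink₁ v (shrinkBound r (length vs) s) u len
    with zs , σ , lenz , monos ← shrink vs s (AllPairs-resp-⊆ τ u) (≤-reflexive (sym leny))
    = zs , ⊆-trans σ τ , lenz , (κ , All-resp-⊆ σ mono) ∷ monos

  -- The outcome of one greedy Ramsey round: a picked vertex sees all later picked vertices in one
  -- colour and each `rest j` in one colour, but these colours still vary with the vertex.
  record Picks {q} (L : List Vertex) (F : Fin q → List Vertex) (M N : ℕ) : Set where
    field
      picked        : List Vertex
      picked⊆       : picked ⊆ L
      length-picked : length picked ≡ M
      rest          : Fin q → List Vertex
      rest⊆         : ∀ j → rest j ⊆ F j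
      length-rest   : ∀ j → length (rest j) ≡ suc N
      -- The colour of an edge from a picked vertex x is read off at the anchors.
      anchor₀       : Vertex
      anchor₀∈      : anchor₀ ∈ L
      anchor        : Fin q → Vertex
      anchor∈       : ∀ j → anchor j ∈ rest j
      inside        : AllPairs (λ x → Edge (c x anchor₀) x) picked
      across        : ∀ j → All (λ x → All (Edge (c x (anchor j)) x) (rest j)) picked

  -- The head `v` of `L` is picked, and the tail and every `F j` are cut down to a majority colour
  -- seen from `v`. The anchors come out of the recursive call, so they lie in the lists already cut
  -- down for `v`.
  pick : ∀ {q} M N (L : List Vertex) (F : Fin q → List Vertex) →
    Unique L → (∀ j → Unique (F j)) →
    picksBound r M N ≤ length L → (∀ j → picksBound r M N ≤ length (F j)) → Picks L F M N
  pick zero N (v ∷ L) F uL uF lenL lenF = record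
    { picked        = []
    ; picked⊆       = minimum (v ∷ L)
    ; length-picked = refl
    ; rest          = λ j → proj₁ (cut j)
    ; rest⊆         = λ j → proj₁ (proj₂ (cut j))
    ; length-rest   = λ j → proj₂ (proj₂ (cut j))
    ; anchor₀       = v
    ; anchor₀∈      = here refl
    ; anchor        = λ j → proj₁ (first j)
    ; anchor∈       = λ j → proj₂ (first j)
    ; inside        = []
    ; across        = λ _ → []
    }
    where
    cut   = λ j → takeExactly (suc N) (F j) (lenF j)
    first = λ j → nonempty (proj₁ (cut j)) (proj₂ (proj₂ (cut j)))
  pick (suc M) N (v ∷ L) F (v∉L ∷ uL) uF (s≤s lenL) lenF
    with κ₀ , L₁ , τ₀ , len₀ , mono₀ ← shrink₁ v (picksBound r M N) uL lenL
    = record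
    { picked        = v ∷ picked
    ; picked⊆       = refl ∷ ⊆-trans picked⊆ τ₀
    ; length-picked = cong suc length-picked
    ; rest          = rest
    ; rest⊆         = λ j → ⊆-trans (rest⊆ j) (F₁⊆ j)
    ; length-rest   = length-rest
    ; anchor₀       = anchor₀
    ; anchor₀∈      = there (Sublist.lookup τ₀ anchor₀∈)
    ; anchor        = anchor
    ; anchor∈       = anchor∈
    ; inside        = All-resp-⊆ picked⊆ (reanchor anchor₀∈ mono₀) ∷ inside
    ; across        = λ j → reanchor (anchor∈ j) (All-resp-⊆ (rest⊆ j) (mono j)) ∷ across j
    }
    where
    step = λ j → shrink₁ v (picksBound r M N) (uF j) (≤-trans (n≤1+n _) (lenF j))
    F₁ = λ j → proj₁ (proj₂ (step j))
    F₁⊆ : ∀ j → F₁ j ⊆ F j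
    F₁⊆ j = proj₁ (proj₂ (proj₂ (step j)))
    mono : ∀ j → All (Edge (proj₁ (step j)) v) (F₁ j)
    mono j = proj₂ (proj₂ (proj₂ (proj₂ (step j))))
    open Picks (pick M N L₁ F₁ (AllPairs-resp-⊆ τ₀ uL) (λ j → AllPairs-resp-⊆ (F₁⊆ j) (uF j))
      (≤-reflexive (sym len₀)) (λ j → ≤-reflexive (sym (proj₁ (proj₂ (proj₂ (proj₂ (step j))))))))

  record Homogeneous {I : Set} (F : I → List Vertex) : Set where
    field
      inner : ∀ i → ∃ λ κ → AllPairs (Edge κ) (F i)
      outer : ∀ {i j} → i ≢ j → ∃ λ κ → Edges κ (F i) (F j)
  open Homogeneous

  Homogeneous-⊆ : ∀ {I} {F G : I → List Vertex} → (∀ i → G i ⊆ F i) → Homogeneous F → Homogeneous G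
  Homogeneous-⊆ G⊆F h .inner i with κ , es ← h .inner i = κ , AllPairs-resp-⊆ (G⊆F i) es
  Homogeneous-⊆ G⊆F h .outer {i} {j} i≢j with κ , es ← h .outer i≢j =
    κ , Edges-⊆ (G⊆F i) (G⊆F j) es

  -- Vertices picked from the first list are thinned until their colours towards all anchors agree,
  -- which makes that list homogeneous inside and towards every `rest j`. The other lists are then
  -- homogenised within `rest`.
  homogenise : ∀ q s (F : Fin q → List Vertex) → (∀ j → Unique (F j)) →
    (∀ j → homogeniseBound r q s ≤ length (F j)) →
    ∃ λ G → (∀ j → G j ⊆ F j) × (∀ j → length (G j) ≡ s) × Homogeneous G
  homogenise zero    s F u len = F , (λ ()) , (λ ()) , record { inner = λ () ; outer = λ {} }
  homogenise (suc q) s F u len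
    = G , G⊆F , length-G , G-homogeneous
    where
    open Picks (pick (s * r ^ suc q) (homogeniseBound r q s) (F zero) (F ∘ suc)
      (u zero) (u ∘ suc) (len zero) (len ∘ suc))
    types : Fin (suc q) → Vertex → Fin r
    types zero    x = c x anchor₀
    types (suc j) x = c x (anchor j)
    selection = pigeonholes (suc q) types s picked (≤-reflexive (sym length-picked))
    G₀ = proj₁ selection
    τ : G₀ ⊆ picked
    τ = proj₁ (proj₂ selection)
    same-type = proj₂ (proj₂ (proj₂ selection))
    recursion = homogenise q s rest (λ j → AllPairs-resp-⊆ (rest⊆ j) (u (suc j)))
      -- The `suc` in the length of `rest j` secures an anchor; the recursion asks for one vertex
      -- fewer.
      (λ j → ≤-trans (n≤1+n _) (≤-reflexive (sym (length-rest j))))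
    G₊ = proj₁ recursion
    σ : ∀ j → G₊ j ⊆ rest j
    σ = proj₁ (proj₂ recursion)
    G : Fin (suc q) → List Vertex
    G zero    = G₀
    G (suc j) = G₊ j
    G⊆F : ∀ j → G j ⊆ F j
    G⊆F zero    = ⊆-trans τ picked⊆
    G⊆F (suc j) = ⊆-trans (σ j) (rest⊆ j)
    length-G : ∀ j → length (G j) ≡ s
    length-G zero    = proj₁ (proj₂ (proj₂ selection))
    length-G (suc j) = proj₁ (proj₂ (proj₂ recursion)) j
    G₀-inner : ∀ {κ xs} → All (λ x → c x anchor₀ ≡ κ) xs →
      AllPairs (λ x → Edge (c x anchor₀) x) xs → AllPairs (Edge κ) xs
    G₀-inner []       []       = []
    G₀-inner (eq ∷ eqs) (es ∷ ess) = All.map (λ (x≢y , cxy) → x≢y , trans cxy eq) es ∷ G₀-inner eqs ess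
    G₀-outer : ∀ j → ∃ λ κ → Edges κ G₀ (G₊ j)
    G₀-outer j with κ , eqs ← same-type (suc j) = κ , All.zipWith
      (λ (eq , es) → All.map (λ (x≢y , cxy) → x≢y , trans cxy eq) (All-resp-⊆ (σ j) es))
      (eqs , All-resp-⊆ τ (across j))
    G-homogeneous : Homogeneous G
    G-homogeneous .inner zero    with κ , eqs ← same-type zero =
      κ , G₀-inner eqs (AllPairs-resp-⊆ τ inside)
    G-homogeneous .inner (suc j) = proj₂ (proj₂ (proj₂ recursion)) .inner j
    G-homogeneous .outer {zero}  {zero}  0≢0 = contradiction refl 0≢0
    G-homogeneous .outer {zero}  {suc j} _   = G₀-outer j
    G-homogeneous .outer {suc i} {zero}  _   with κ , es ← G₀-outer i = κ , Edges-sym es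
    G-homogeneous .outer {suc i} {suc j} i≢j = proj₂ (proj₂ (proj₂ recursion)) .outer (i≢j ∘ cong suc)

-- Indexing by `Fin` and the sizes of the parts.

AllPairs-lookup : ∀ {R : A → A → Set} → (∀ {x y} → R x y → R y x) →
  ∀ {xs} → AllPairs R xs → ∀ {i j} → i ≢ j → R (lookup xs i) (lookup xs j)
AllPairs-lookup R-sym (r ∷ rs) {zero}  {zero}  0≢0 = contradiction refl 0≢0
AllPairs-lookup R-sym (r ∷ rs) {zero}  {suc j} _   = All.lookup r (∈-lookup j)
AllPairs-lookup R-sym (r ∷ rs) {suc i} {zero}  _   = R-sym (All.lookup r (∈-lookup i))
AllPairs-lookup R-sym (r ∷ rs) {suc i} {suc j} i≢j = AllPairs-lookup R-sym rs (i≢j ∘ cong suc)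

length-concatMap : ∀ {s} (f : A → List B) → (∀ x → length (f x) ≡ s) →
  ∀ xs → length (concatMap f xs) ≡ length xs * s
length-concatMap f len []       = refl
length-concatMap f len (x ∷ xs) =
  trans (length-++ (f x)) (cong₂ _+_ (len x) (length-concatMap f len xs))

∑-allFin-suc : ∀ n (f : Fin (suc n) → ℕ) → ∑ (allFin (suc n)) f ≡ f zero + ∑ (allFin n) (f ∘ suc)
∑-allFin-suc n f = cong (λ xs → f zero + sum xs)
  (trans (map-tabulate suc f) (sym (map-tabulate id (f ∘ suc))))

∑-allFin-+ : ∀ m n (f : Fin (m + n) → ℕ) →
  ∑ (allFin (m + n)) f ≡ ∑ (allFin m) (λ i → f (i ↑ˡ n)) + ∑ (allFin n) (λ j → f (m ↑ʳ j))
∑-allFin-+ zero    n f = refl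
∑-allFin-+ (suc m) n f = begin
  ∑ (allFin (suc m + n)) f
    ≡⟨ ∑-allFin-suc (m + n) f ⟩
  f zero + ∑ (allFin (m + n)) (f ∘ suc)
    ≡⟨ cong (f zero +_) (∑-allFin-+ m n (f ∘ suc)) ⟩
  f zero + (∑ (allFin m) (λ i → f (suc (i ↑ˡ n))) + rest)
    ≡⟨ +-assoc (f zero) _ rest ⟨
  f zero + ∑ (allFin m) (λ i → f (suc (i ↑ˡ n))) + rest
    ≡⟨ cong (_+ rest) (∑-allFin-suc m (λ i → f (i ↑ˡ n))) ⟨
  ∑ (allFin (suc m)) (λ i → f (i ↑ˡ n)) + rest ∎
  where
  open ≡-Reasoning
  rest = ∑ (allFin n) (λ j → f (suc m ↑ʳ j))

∑-allFin-* : ∀ k t (f : Fin (k * t) → ℕ) →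
  ∑ (allFin (k * t)) f ≡ ∑ (allFin k) (λ i → ∑ (allFin t) (λ x → f (combine i x)))
∑-allFin-* zero    t f = refl
∑-allFin-* (suc k) t f = begin
  ∑ (allFin (t + k * t)) f
    ≡⟨ ∑-allFin-+ t (k * t) f ⟩
  ∑ (allFin t) (λ x → f (x ↑ˡ (k * t))) + ∑ (allFin (k * t)) (λ u → f (t ↑ʳ u))
    ≡⟨ cong (∑ (allFin t) (λ x → f (x ↑ˡ (k * t))) +_) (∑-allFin-* k t (λ u → f (t ↑ʳ u))) ⟩
  ∑ (allFin t) (λ x → f (x ↑ˡ (k * t))) + ∑ (allFin k) (λ i → ∑ (allFin t) (λ x → f (t ↑ʳ combine i x)))
    ≡⟨ ∑-allFin-suc k (λ i → ∑ (allFin t) (λ x → f (combine i x))) ⟨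
  ∑ (allFin (suc k)) (λ i → ∑ (allFin t) (λ x → f (combine i x))) ∎
  where open ≡-Reasoning

∑-ind-≟ : ∀ k (i : Fin k) → ∑ (allFin k) (λ j → ind (j Fin.≟ i)) ≡ 1
∑-ind-≟ (suc k) zero = trans (∑-allFin-suc k (λ j → ind (j Fin.≟ zero)))
  (cong suc (trans (∑-const (allFin k) 0) (*-zeroʳ (length (allFin k)))))
∑-ind-≟ (suc k) (suc i) = trans (∑-allFin-suc k (λ j → ind (j Fin.≟ suc i)))
  (trans (∑-cong (allFin k) (λ j → ind-cong (suc j Fin.≟ suc i) (j Fin.≟ i) Fin.suc-injective (cong suc)))
         (∑-ind-≟ k i))

-- Reindexing along the bijection `combine` turns the count into `t` copies of the number of `j`
-- equal to `i`.
partSize-quotient : ∀ k t (i : Fin k) → partSize (quotient {k} t) i ≡ t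
partSize-quotient k t i = begin
  partSize (quotient {k} t) i
    ≡⟨ length-filter-∑ (λ u → quotient {k} t u Fin.≟ i) (allFin (k * t)) ⟩
  ∑ (allFin (k * t)) (λ u → ind (quotient {k} t u Fin.≟ i))
    ≡⟨ ∑-allFin-* k t (λ u → ind (quotient {k} t u Fin.≟ i)) ⟩
  ∑ (allFin k) (λ j → ∑ (allFin t) (λ x → ind (quotient {k} t (combine j x) Fin.≟ i)))
    ≡⟨ ∑-cong (allFin k) (λ j → ∑-cong (allFin t) (λ x →
         cong (λ j′ → ind (j′ Fin.≟ i)) (cong proj₁ (Fin.remQuot-combine j x)))) ⟩
  ∑ (allFin k) (λ j → ∑ (allFin t) (λ _ → ind (j Fin.≟ i)))
    ≡⟨ ∑-cong (allFin k) (λ j → ∑-const (allFin t) (ind (j Fin.≟ i))) ⟩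
  ∑ (allFin k) (λ j → length (allFin t) * ind (j Fin.≟ i))
    ≡⟨ ∑-*ˡ (allFin k) (length (allFin t)) (λ j → ind (j Fin.≟ i)) ⟩
  length (allFin t) * ∑ (allFin k) (λ j → ind (j Fin.≟ i))
    ≡⟨ cong₂ _*_ (length-tabulate {n = t} id) (∑-ind-≟ k i) ⟩
  t * 1
    ≡⟨ *-identityʳ t ⟩
  t ∎
  where open ≡-Reasoning

-- From rainbow blocks to a member of the family.

module Blocks {n ρ : ℕ} (c : EdgeColoring n (suc ρ)) (c-sym : Symmetric c) where
  private r = suc ρ
  open Ramsey c c-sym

  -- The case `i ≡ j` is included, so one clause covers the edges inside a block and those between
  -- blocks. Through `Edge` it also makes `P` injective.
  IsBlocks : ∀ {k t} → (Fin k × Fin t → Fin n) → Set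
  IsBlocks P = ∀ i j → ∃ λ κ → ∀ x y → (i , x) ≢ (j , y) → Edge κ (P (i , x)) (P (j , y))

  IsRainbow : ∀ {k t} → (Fin k × Fin t → Fin n) → Set
  IsRainbow P = ∀ a → ∃ λ u → ∃ λ v → u ≢ v × c (P u) (P v) ≡ a

  isRainbow? : ∀ {k t} (P : Fin k × Fin t → Fin n) → Dec (IsRainbow P)
  isRainbow? P = Fin.all? λ a → any-pair? λ u → any-pair? λ v →
    ¬? (≡-dec Fin._≟_ Fin._≟_ u v) ×-dec (c (P u) (P v) Fin.≟ a)
    where
    any-pair? : ∀ {k t} {Q : Fin k × Fin t → Set} → Decidable Q → Dec (∃ Q)
    any-pair? Q? = map′ (λ (i , x , q) → (i , x) , q) (λ ((i , x) , q) → i , x , q)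
      (Fin.any? λ i → Fin.any? λ x → Q? (i , x))

  removeBlock : ∀ {k t} → (Fin (suc k) × Fin t → Fin n) → Fin (suc k) → Fin k × Fin t → Fin n
  removeBlock P i (j , x) = P (punchIn i j , x)

  IsMinimal : ∀ {k t} → (Fin k × Fin t → Fin n) → Set
  IsMinimal {zero}  P = ⊤
  IsMinimal {suc k} P = ∀ i → ¬ IsRainbow (removeBlock P i)

  -- Being rainbow is decidable on finitely many blocks, so a removable block can be searched for;
  -- the recursion ends because the number of blocks drops.
  minimise : ∀ {k t} (P : Fin k × Fin t → Fin n) → IsBlocks P → IsRainbow P →
    ∃ λ k′ → ∃ λ (P′ : Fin k′ × Fin t → Fin n) → IsBlocks P′ × IsRainbow P′ × IsMinimal P′
  minimise {zero}  P blocks rainbow = zero , P , blocks , rainbow , tt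
  minimise {suc k} P blocks rainbow with Fin.any? (λ i → isRainbow? (removeBlock P i))
  ... | no  none           = suc k , P , blocks , rainbow , λ i rainbowᵢ → none (i , rainbowᵢ)
  ... | yes (i , rainbowᵢ) = minimise (removeBlock P i) blocksᵢ rainbowᵢ
    where
    blocksᵢ : IsBlocks (removeBlock P i)
    blocksᵢ j l with κ , es ← blocks (punchIn i j) (punchIn i l) =
      κ , λ x y ne → es x y λ eq →
        ne (cong₂ _,_ (Fin.punchIn-injective i j l (cong proj₁ eq)) (cong proj₂ eq))

  module Embedded {k t} (P : Fin k × Fin t → Fin n) (blocks : IsBlocks P) where

    φ : Fin (k * t) → Fin n
    φ u = P (remQuot {k} t u)

    remQuot-≢ : ∀ {u v} → u ≢ v → remQuot {k} t u ≢ remQuot {k} t v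
    remQuot-≢ {u} {v} u≢v eq = u≢v (begin
      u                                 ≡⟨ Fin.combine-remQuot {k} t u ⟨
      uncurry combine (remQuot {k} t u) ≡⟨ cong (uncurry combine) eq ⟩
      uncurry combine (remQuot {k} t v) ≡⟨ Fin.combine-remQuot {k} t v ⟩
      v                                 ∎)
      where open ≡-Reasoning

    -- Pulling `c` back along `φ` makes the colour condition of `ContainsCopy` hold by `refl`.
    H : EdgeColoring (k * t) r
    H u v = c (φ u) (φ v)

    blockColour : Fin k → Fin k → Fin r
    blockColour i j = proj₁ (blocks i j)

    φ-edge : ∀ {u v} → u ≢ v → Edge (blockColour (quotient {k} t u) (quotient {k} t v)) (φ u) (φ v)
    φ-edge u≢v = proj₂ (blocks _ _) _ _ (remQuot-≢ u≢v)

    φ-injective : Injective _≡_ _≡_ φ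
    φ-injective {u} {v} eq with u Fin.≟ v
    ... | yes u≡v = u≡v
    ... | no  u≢v = contradiction eq (proj₁ (φ-edge u≢v))

    H-blockwise : ∀ u v u′ v′ → u ≢ v → u′ ≢ v′ → quotient {k} t u ≡ quotient {k} t u′ →
      quotient {k} t v ≡ quotient {k} t v′ → H u v ≡ H u′ v′
    H-blockwise u v u′ v′ u≢v u′≢v′ pu pv =
      trans (proj₂ (φ-edge u≢v)) (trans (cong₂ blockColour pu pv) (sym (proj₂ (φ-edge u′≢v′))))

    H-rainbow : IsRainbow P → ∀ a → ∃ λ u → ∃ λ v → u ≢ v × H u v ≡ a
    H-rainbow rainbow a with u , v , u≢v , eq ← rainbow a =
      uncurry combine u , uncurry combine v ,
      (λ e → u≢v (trans (sym (inverse u)) (trans (cong (remQuot {k} t) e) (inverse v)))) ,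
      trans (cong₂ (λ x y → c (P x) (P y)) (inverse u) (inverse v)) eq
      where
      inverse : ∀ u → remQuot {k} t (uncurry combine u) ≡ u
      inverse (i , x) = Fin.remQuot-combine i x

  RainbowAvoiding : ∀ {k t} → (Fin k × Fin t → Fin n) → Fin k → Set
  RainbowAvoiding P i = ∀ a → ∃ λ u → ∃ λ v → u ≢ v × proj₁ u ≢ i × proj₁ v ≢ i × c (P u) (P v) ≡ a

  -- Vertices outside block `i` survive its removal under the index shift `punchOut`, so a rainbow
  -- family of edges avoiding the block would contradict minimality.
  minimal⇒¬avoiding : ∀ {k t} (P : Fin k × Fin t → Fin n) → IsMinimal P → ∀ i → ¬ RainbowAvoiding P i
  minimal⇒¬avoiding {suc k} {t} P minimal i avoiding = minimal i λ a →
    let (u , v , u≢v , u∉ , v∉ , eq) = avoiding a in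
    lower u u∉ , lower v v∉ ,
    (λ e → u≢v (trans (sym (raise-lower u u∉)) (trans (cong raise e) (raise-lower v v∉)))) ,
    trans (cong₂ (λ x y → c (P x) (P y)) (raise-lower u u∉) (raise-lower v v∉)) eq
    where
    lower : (u : Fin (suc k) × Fin t) → proj₁ u ≢ i → Fin k × Fin t
    lower (j , x) j≢i = punchOut (≢-sym j≢i) , x
    raise : Fin k × Fin t → Fin (suc k) × Fin t
    raise (j , x) = punchIn i j , x
    raise-lower : ∀ u u∉ → raise (lower u u∉) ≡ u
    raise-lower (j , x) j≢i = cong (_, x) (Fin.punchIn-punchOut (≢-sym j≢i))

  rainbowBlocks⇒copy : ∀ {k t} (P : Fin k × Fin t → Fin n) → IsBlocks P → IsRainbow P →
    ∃ λ h → Σ (EdgeColoring h r) λ H → InFamily t r h H × ContainsCopy c H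
  rainbowBlocks⇒copy {t = t} P₀ blocks₀ rainbow₀
    with k , P , blocks , rainbow , minimal ← minimise P₀ blocks₀ rainbow₀
    = k * t , H ,
      ( (λ u v → c-sym (φ u) (φ v)) , k , refl , quotient {k} t
      , partSize-quotient k t , H-blockwise , H-rainbow rainbow
      , λ i avoiding → minimal⇒¬avoiding P minimal i λ a →
          let (u , v , u≢v , u∉ , v∉ , eq) = avoiding a in
          remQuot {k} t u , remQuot {k} t v , remQuot-≢ u≢v , u∉ , v∉ , eq ) ,
      φ , φ-injective , λ _ _ _ → refl
    where open Embedded P blocks

  module _ {k t} (F : Fin k → List (Fin n)) (F-hom : Homogeneous F) (len : ∀ i → length (F i) ≡ t) where
    open Homogeneous F-hom

    entry : Fin k × Fin t → Fin n
    entry (i , x) = lookup (F i) (cast (sym (len i)) x)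

    entry∈ : ∀ u → entry u ∈ F (proj₁ u)
    entry∈ (i , x) = ∈-lookup (cast (sym (len i)) x)

    entry-isBlocks : IsBlocks entry
    entry-isBlocks i j with i Fin.≟ j
    ... | no i≢j with κ , es ← outer i≢j =
      κ , λ x y _ → All.lookup (All.lookup es (entry∈ (i , x))) (entry∈ (j , y))
    ... | yes refl with κ , es ← inner i =
      κ , λ x y ne → AllPairs-lookup Edge-sym es λ eq → ne (cong (i ,_) (cast-injective x y eq))
      where
      cast-injective : ∀ x y → cast (sym (len i)) x ≡ cast (sym (len i)) y → x ≡ y
      cast-injective x y eq = Fin.toℕ-injective
        (trans (sym (Fin.toℕ-cast (sym (len i)) x)) (trans (cong toℕ eq) (Fin.toℕ-cast (sym (len i)) y)))

  -- Assembling the 2r blocks.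

  module _ {t} (A B : Fin r → List (Fin n)) (A-hom : Homogeneous A) (B-hom : Homogeneous B)
           (length-A : ∀ a → length (A a) ≡ suc t) (length-B : ∀ b → length (B b) ≡ suc t)
           (A-to-B : ∀ a b → ∃ λ κ → Edges κ (A a) (B b)) (A-to-B-same : ∀ a → Edges a (A a) (B a)) where
    open Homogeneous

    AB : Fin r ⊎ Fin r → List (Fin n)
    AB = [ A , B ]′

    length-AB : ∀ i → length (AB i) ≡ suc t
    length-AB (inj₁ a) = length-A a
    length-AB (inj₂ b) = length-B b

    AB-hom : Homogeneous AB
    AB-hom .inner (inj₁ a) = A-hom .inner a
    AB-hom .inner (inj₂ b) = B-hom .inner b
    AB-hom .outer {inj₁ a} {inj₁ b} ne = A-hom .outer (ne ∘ cong inj₁)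
    AB-hom .outer {inj₁ a} {inj₂ b} _  = A-to-B a b
    AB-hom .outer {inj₂ b} {inj₁ a} _  with κ , es ← A-to-B a b = κ , Edges-sym es
    AB-hom .outer {inj₂ a} {inj₂ b} ne = B-hom .outer (ne ∘ cong inj₂)

    F : Fin (r + r) → List (Fin n)
    F i = AB (splitAt r i)

    F-hom : Homogeneous F
    F-hom .inner i = AB-hom .inner (splitAt r i)
    F-hom .outer {i} {j} i≢j = AB-hom .outer {splitAt r i} {splitAt r j} λ eq → i≢j
      (trans (sym (Fin.join-splitAt r r i)) (trans (cong (join r r) eq) (Fin.join-splitAt r r j)))

    length-F : ∀ i → length (F i) ≡ suc t
    length-F i = length-AB (splitAt r i)

    -- Colour `a` is seen between the block of `A a` and the block of `B a`; the block size is a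
    -- successor, so each has an entry at index `zero`.
    AB-rainbow : IsRainbow (entry F F-hom length-F)
    AB-rainbow a = u , v , (λ u≡v → proj₁ edge (cong place u≡v)) , proj₂ edge
      where
      place = entry F F-hom length-F
      u v : Fin (r + r) × Fin (suc t)
      u = join r r (inj₁ a) , zero
      v = join r r (inj₂ a) , zero
      edge : Edge a (place u) (place v)
      edge = All.lookup (All.lookup (A-to-B-same a)
        (subst (λ i → place u ∈ AB i) (Fin.splitAt-join r r (inj₁ a)) (entry∈ F F-hom length-F u)))
        (subst (λ i → place v ∈ AB i) (Fin.splitAt-join r r (inj₂ a)) (entry∈ F F-hom length-F v))

    bipartite⇒copy : ∃ λ h → Σ (EdgeColoring h r) λ H → InFamily (suc t) r h H × ContainsCopy c H
    bipartite⇒copy =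
      rainbowBlocks⇒copy (entry F F-hom length-F) (entry-isBlocks F F-hom length-F) AB-rainbow

  -- Towards B a the colour is a already, so only the other r ∸ 1 colours need to agree:
  -- this is why suc t * r ^ (r ∸ 1) vertices in each A a suffice.
  unify : ∀ {t} (A B : Fin r → List (Fin n)) →
    (∀ a → suc t * r ^ ρ ≤ length (A a)) → (∀ b → length (B b) ≡ suc t) →
    (∀ a b → All (λ x → ∃ λ κ → All (Edge κ x) (B b)) (A a)) →
    (∀ a → All (λ x → All (λ y → c x y ≡ a) (B a)) (A a)) →
    ∃ λ A′ → (∀ a → A′ a ⊆ A a) × (∀ a → length (A′ a) ≡ suc t) ×
      (∀ a b → ∃ λ κ → Edges κ (A′ a) (B b)) × (∀ a → Edges a (A′ a) (B a))
  unify {t} A B length-A length-B A-to-B coloured =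
    A′ , A′⊆A , (λ a → proj₁ (proj₂ (proj₂ (selection a)))) , to-B , to-B-same
    where
    anchor : ∀ b → ∃ (_∈ B b)
    anchor b = nonempty (B b) (length-B b)
    anchored : ∀ a b → All (λ x → All (Edge (c x (proj₁ (anchor b))) x) (B b)) (A a)
    anchored a b = All.map (λ (_ , es) → reanchor (proj₂ (anchor b)) es) (A-to-B a b)
    selection = λ a → pigeonholes ρ (λ j x → c x (proj₁ (anchor (punchIn a j)))) (suc t) (A a) (length-A a)
    A′ : Fin r → List (Fin n)
    A′ a = proj₁ (selection a)
    A′⊆A : ∀ a → A′ a ⊆ A a
    A′⊆A a = proj₁ (proj₂ (selection a))
    to-B-same : ∀ a → Edges a (A′ a) (B a)
    to-B-same a = All-resp-⊆ (A′⊆A a) (All.zipWith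
      (λ (es , eqs) → All.zipWith (λ ((x≢y , _) , eq) → x≢y , eq) (es , eqs))
      (anchored a a , coloured a))
    to-B : ∀ a b → ∃ λ κ → Edges κ (A′ a) (B b)
    to-B a b with a Fin.≟ b
    ... | yes refl = a , to-B-same a
    ... | no a≢b with κ , eqs ← proj₂ (proj₂ (proj₂ (selection a))) (punchOut a≢b) =
      κ , All.zipWith (λ (eq , es) → All.map (λ (x≢y , cxy) → x≢y ,
            trans cxy (trans (cong (λ b → c _ (proj₁ (anchor b))) (sym (Fin.punchIn-punchOut a≢b))) eq)) es)
          (eqs , All-resp-⊆ (A′⊆A a) (anchored a b))

  -- Each `B b` is shrunk against all `r * s` vertices of the lists `A a` together, which also makes
  -- it disjoint from every `A a`.
  separate : ∀ {s} N (A B : Fin r → List (Fin n)) → (∀ a → length (A a) ≡ s) →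
    (∀ b → Unique (B b)) → (∀ b → shrinkBound r (r * s) N ≤ length (B b)) →
    ∃ λ B′ → (∀ b → B′ b ⊆ B b) × (∀ b → length (B′ b) ≡ N) ×
      (∀ a b → All (λ x → ∃ λ κ → All (Edge κ x) (B′ b)) (A a))
  separate {s} N A B length-A B-unique long =
    (λ b → proj₁ (shrunk b)) , (λ b → proj₁ (proj₂ (shrunk b))) ,
    (λ b → proj₁ (proj₂ (proj₂ (shrunk b)))) ,
    λ a b → All.tabulate λ x∈ → All.lookup (proj₂ (proj₂ (proj₂ (shrunk b))))
      (∈-concatMap⁺ A (lose (∈-allFin a) x∈))
    where
    length-all : length (concatMap A (allFin r)) ≡ r * s
    length-all = trans (length-concatMap A length-A (allFin r)) (cong (_* s) (length-tabulate {n = r} id))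
    shrunk = λ b → shrink (concatMap A (allFin r)) N (B-unique b)
      (subst (λ m → shrinkBound r m N ≤ length (B b)) (sym length-all) (long b))

  Rich : (s M : ℕ) → Fin r → List (Fin n) → Set
  Rich s M a U = ∀ xs → length xs ≡ s → All (_∈ U) xs →
    ∃ λ ys → Unique ys × M ≤ length ys × All (λ x → All (λ y → c x y ≡ a) ys) xs

  -- The lists `B b` are settled first, by passing to sublists, which keeps what was known towards
  -- `A`. Only then is each `A a` thinned by type, since the types are read off at the final `B b`.
  rich⇒copy : ∀ {t s} → suc t * r ^ ρ ≤ s → (U : Fin r → List (Fin n)) → (∀ a → Unique (U a)) →
    (∀ a → homogeniseBound r r s ≤ length (U a)) →
    (∀ a → Rich s (shrinkBound r (r * s) (homogeniseBound r r (suc t))) a (U a)) →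
    ∃ λ h → Σ (EdgeColoring h r) λ H → InFamily (suc t) r h H × ContainsCopy c H
  rich⇒copy {t} {s} s≤ U U-unique U-long U-rich
    with A , A⊆U , length-A , A-hom ← homogenise r s U U-unique U-long
    with neighbours ← (λ a → U-rich a (A a) (length-A a) (All.tabulate (Sublist.lookup (A⊆U a))))
    with B₀-unique ← (λ b → proj₁ (proj₂ (neighbours b)))
    with B₁ , B₁⊆ , length-B₁ , A-to-B₁ ← separate (homogeniseBound r r (suc t)) A
           (λ a → proj₁ (neighbours a)) length-A B₀-unique (λ b → proj₁ (proj₂ (proj₂ (neighbours b))))
    -- Common neighbourhoods for different colours may overlap; homogenising also makes the lists
    -- `B b` pairwise disjoint.
    with B , B⊆ , length-B , B-hom ← homogenise r (suc t) B₁
           (λ b → AllPairs-resp-⊆ (B₁⊆ b) (B₀-unique b)) (λ b → ≤-reflexive (sym (length-B₁ b)))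
    with A′ , A′⊆ , length-A′ , A′-to-B , A′-to-B-same ← unify A B
           (λ a → ≤-trans s≤ (≤-reflexive (sym (length-A a)))) length-B
           (λ a b → All.map (λ (κ , es) → κ , All-resp-⊆ (B⊆ b) es) (A-to-B₁ a b))
           (λ a → All.map (All-resp-⊆ (⊆-trans (B⊆ a) (B₁⊆ a))) (proj₂ (proj₂ (proj₂ (neighbours a)))))
    = bipartite⇒copy A′ B (Homogeneous-⊆ A′⊆ A-hom) B-hom length-A′ length-B A′-to-B A′-to-B-same

-- Choice of the constants and the numerical bound.

-- The rounded-down root, by induction on `X`: raising `X` by one raises the root by at most one.
integerRoot : ∀ k X → ∃ λ m → m ^ suc k ≤ X × X < suc m ^ suc k
integerRoot k zero    = 0 , z≤n , ≤-reflexive (sym (^-zeroˡ (suc k)))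
integerRoot k (suc X) with m , lower , upper ← integerRoot k X with suc X <? suc m ^ suc k
... | yes lt = m , m≤n⇒m≤1+n lower , lt
... | no ¬lt = suc m , ≮⇒≥ ¬lt , ≤-<-trans upper (^-monoˡ-< (suc k) (n<1+n (suc m)))

edgesOfColor-∑ : ∀ {n r} (c : EdgeColoring n r) a → edgesOfColor c a ≡
  ∑ (allFin n) (λ u → ∑ (allFin n) (λ v → ind ((u Fin.<? v) ×-dec (c u v Fin.≟ a))))
edgesOfColor-∑ {n} c a =
  trans (length-filter-∑ _ (cartesianProduct (allFin n) (allFin n)))
        (∑-cartesianProductWith _,_ (allFin n) (allFin n) _)

module _ (ρ t k : ℕ) (s≤ : suc t * suc ρ ^ ρ ≤ suc k) where
  private
    r = suc ρ
    s = suc k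
    L = homogeniseBound r r s
    M = shrinkBound r (r * s) (homogeniseBound r r (suc t))

  -- The outer `suc` makes the constant nonzero, so that it is at most its own power `constant ^ s`
  -- in `exBound`.
  constant : ℕ
  constant = suc (L + M ^ s)

  many-edges⇒copy : ∀ {n m} → constant * n ^ (s + k) < suc m ^ s → ExAdmissible r (suc t) n m
  many-edges⇒copy {n} {m} m-large c c-sym edges = Blocks.rich⇒copy c c-sym {t} {s} s≤
    (λ a → proj₁ (rich a)) (λ a → proj₁ (proj₂ (rich a)))
    (λ a → proj₁ (proj₂ (proj₂ (rich a)))) (λ a → proj₂ (proj₂ (proj₂ (rich a))))
    where
    module _ (a : Fin r) where
      -- Restricting to `u < v` counts each edge once, so the number of related pairs is exactly
      -- `edgesOfColor c a`.
      open DependentRandomChoice (λ u v → (u Fin.<? v) ×-dec (c u v Fin.≟ a))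

      dense : Dense k M L
      dense = begin-strict
        (L + M ^ s) * n ^ (s + k)  ≤⟨ *-monoˡ-≤ (n ^ (s + k)) (n≤1+n (L + M ^ s)) ⟩
        constant * n ^ (s + k)     <⟨ m-large ⟩
        suc m ^ s                  ≤⟨ ^-monoˡ-≤ s (edges a) ⟩
        edgesOfColor c a ^ s       ≡⟨ cong (_^ s) (edgesOfColor-∑ c a) ⟩
        _                          ∎
        where open ≤-Reasoning

      rich : ∃ λ U → Unique U × L ≤ length U × Blocks.Rich c c-sym s M a U
      rich =
        let (U , unique , long , common) = dependent-random-choice k M L dense in
        U , unique , long , λ xs len xs⊆U →
          let (ys , ys-unique , ys-long , es) = common xs len xs⊆U in
          ys , ys-unique , ys-long , All.map (All.map proj₂) es

  -- The witness `m` is the integer `s`-th root of the threshold: `suc m` passes the threshold, as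
  -- `many-edges⇒copy` demands, while `m` itself stays below it.
  exBound : ∀ n → ExBound r (suc t) n constant s
  exBound n =
    let (m , lower , upper) = integerRoot k (constant * n ^ (s + k)) in
    m , many-edges⇒copy upper , (begin
      m ^ s                             ≤⟨ lower ⟩
      constant * n ^ (s + k)            ≤⟨ *-monoˡ-≤ (n ^ (s + k)) (m≤m*n constant (constant ^ k) {{m^n≢0 constant k}}) ⟩
      constant ^ s * n ^ (s + k)        ≡⟨ cong (λ e → constant ^ s * n ^ e) (trans (+-comm s k) (cong (k +_) (sym (+-identityʳ s)))) ⟩
      constant ^ s * n ^ (2 * s ∸ 1)    ∎)
    where open ≤-Reasoning

theorem1p6 : (r t : ℕ) → 2 ≤ r → 1 ≤ t →
    Σ ℕ λ C → Σ ℕ λ N → ∀ n → N ≤ n → ExBound r t n C (t * r ^ (r ∸ 1))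
-- The threshold `N` is 0 because `exBound` covers every `n`.
theorem1p6 (suc ρ) (suc t) _ _ = constant ρ t k (≤-reflexive s≡) , 0 , λ n _ →
  subst (ExBound (suc ρ) (suc t) n (constant ρ t k (≤-reflexive s≡))) (sym s≡)
        (exBound ρ t k (≤-reflexive s≡) n)
  where
  -- The exponent t' is positive; writing it as `suc k` gives the tuples a head and the power mean
  -- its exponent.
  k : ℕ
  k = pred (suc t * suc ρ ^ ρ)
  s≡ : suc t * suc ρ ^ ρ ≡ suc k
  s≡ = sym (suc-pred _ {{m*n≢0 (suc t) (suc ρ ^ ρ) {{_}} {{m^n≢0 (suc ρ) ρ}}}})
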